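{- For any integer $k\geq 1$ there is a triangle-free graph with treedepth $\binom{k+1}{2}$ and chromatic number at least $k$.
   Context: Graphs are finite, simple and undirected; chromatic number is the usual (proper) chromatic number. In a rooted tree, the depth of a vertex $v$ is the number of vertices on the path from the root to $v$; the depth of a rooted forest is the maximum depth of its vertices; the closure of a rooted forest $F$ is the graph on $V(F)$ in which two distinct vertices are adjacent if and only if one is an ancestor of the other. The treedepth of a graph $G$ is the minimum depth of a rooted forest $F$ such that $G$ is a spanning subgraph of the closure of $F$. -}

module Defs where

open import Data.Fin using (Fin)
open import Data.List using (List; map; tabulate)
open import Data.List.Extrema.Nat using (max)
open import Data.Maybe using (Maybe; just; nothing)
open import Data.Nat using (ℕ; suc; _≤_)
open import Data.Product using (Σ-syntax; ∃-syntax; _×_; proj₁)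
open import Data.Sum using (_⊎_)
open import Function using (_↔_; Inverse)
open import Level using (0ℓ)
open import Relation.Binary using (Rel; Symmetric; Irreflexive; Decidable; _⇒_)
open import Relation.Binary.Construct.Closure.ReflexiveTransitive using (Star)
open import Relation.Binary.PropositionalEquality using (_≡_; _≢_)
open import Relation.Nullary using (¬_)
open import Relation.Unary using (Pred)

record Graph : Set₁ where
  infix 4 _~_
  field
    V      : Set
    order  : ℕ
    enum   : Fin order ↔ V
    _~_    : Rel V 0ℓ
    ~-sym  : Symmetric _~_
    ~-irr  : Irreflexive _≡_ _~_
    _~?_   : Decidable _~_

  vertices : List V
  vertices = tabulate (Inverse.to enum)

IsMinimum : Pred ℕ 0ℓ → Pred ℕ 0ℓ
IsMinimum P m = P m × (∀ n → P n → m ≤ n)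

TriangleFree : Graph → Set
TriangleFree G = ∀ u v w → u ~ v → v ~ w → ¬ (u ~ w)
  where open Graph G

Colorable : Graph → ℕ → Set
Colorable G c = Σ[ f ∈ (V → Fin c) ] (∀ u v → u ~ v → f u ≢ f v)
  where open Graph G

IsChromaticNumber : Graph → ℕ → Set
IsChromaticNumber G = IsMinimum (Colorable G)

-- PathToRoot parent v n: following parents from v reaches a root (a vertex
-- without parent), and the path has n vertices, counting both v and the root.
data PathToRoot {V : Set} (parent : V → Maybe V) : V → ℕ → Set where
  root : ∀ {v} → parent v ≡ nothing → PathToRoot parent v 1
  step : ∀ {v u n} → parent v ≡ just u → PathToRoot parent u n →
         PathToRoot parent v (suc n)

-- A rooted forest with vertex set V is given by its parent pointers; the field
-- rooted excludes cycles.
record RootedForest (V : Set) : Set where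
  field
    parent : V → Maybe V
    rooted : ∀ v → ∃[ n ] PathToRoot parent v n

  depth : V → ℕ
  depth v = proj₁ (rooted v)

  _AncestorOf_ : Rel V 0ℓ
  u AncestorOf v = Star (λ x y → parent x ≡ just y) v u

  Closure : Rel V 0ℓ
  Closure u v = u ≢ v × (u AncestorOf v ⊎ v AncestorOf u)

-- The forest has the vertex set of G, so the inclusion of adjacency relations
-- says that G is a spanning subgraph of the closure.
HasForestOfDepth : Graph → ℕ → Set
HasForestOfDepth G d =
  Σ[ F ∈ RootedForest V ]
    (_~_ ⇒ RootedForest.Closure F) ×
    max 0 (map (RootedForest.depth F) vertices) ≡ d
  where open Graph G

IsTreedepth : Graph → ℕ → Set
IsTreedepth G = IsMinimum (HasForestOfDepth G)

{-# OPTIONS --safe #-}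
module Submission where

-- A colouring of a graph whose edges join vertices of a rooted forest to their
-- ancestors plays an on-line game along a root-to-leaf path: each new vertex
-- comes with its neighbours among the earlier ones, receives a colour, and the
-- colour selects the child where the game continues.  So it is enough to win
-- this game against k - 1 colours within binom(k+1, 2) vertices, keeping all
-- neighbourhoods independent.  Given an independent set I with s distinct
-- colours, present vertices joined to those members of I whose colour has been
-- met since.  A new vertex either repeats the colour of a member of I not met
-- yet, and replaces that member, or has a new colour, which gives an independent
-- set with s + 1 distinct colours.  The latter happens after at most s + 1
-- vertices, for a total of 1 + 2 + ... + k.  An additional branch of the forest
-- contains a complete bipartite graph, which makes the treedepth exact.

open import Data.Empty.Irrelevant using () renaming (⊥-elim to ⊥-elim-irr)
open import Data.Fin using (Fin; zero; suc; toℕ; inject≤; finToFun; funToFin)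
open import Data.Fin.Properties
  using (any?; all?; injective⇒≤; 0↔⊥; 1↔⊤; +↔⊎; *↔×; toℕ<n; toℕ-injective;
         inject≤-injective; finToFun-funToFin)
  renaming (_≟_ to _≟ᶠ_)
open import Data.List using (List; []; _∷_; length; map; replicate; allFin)
open import Data.List.Extrema.Nat using (argmax; f[xs]≤f[argmax]; max; max≤v⁺; xs≤max)
import Data.List.Membership.DecPropositional as DecMembership
open import Data.List.Membership.Propositional using (_∈_)
open import Data.List.Membership.Propositional.Properties using (∈-tabulate⁺; ∈-map⁺; ∈-allFin)
open import Data.List.Properties using (≡-dec; ∷-injectiveˡ; length-replicate)
open import Data.List.Relation.Unary.All as All using ()
open import Data.List.Relation.Unary.All.Properties using (map⁺)
open import Data.List.Relation.Unary.Any using (here; there)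
open import Data.Maybe using (Maybe; just; nothing)
open import Data.Maybe.Properties using (just-injective)
open import Data.Nat
  using (ℕ; zero; suc; _+_; _*_; _≤_; _<_; _≥_; z≤n; s≤s; s≤s⁻¹; _≟_; _≤?_)
open import Data.Nat.Combinatorics using (_C_; nCk+nC[k+1]≡[n+1]C[k+1]; nC1≡n)
open import Data.Nat.Induction using (<-rec)
open import Data.Nat.Properties hiding (_≟_; _≤?_; suc-injective)
open import Data.Product using (Σ-syntax; ∃-syntax; _×_; _,_; proj₁; proj₂)
open import Data.Product.Function.NonDependent.Propositional using (_×-↔_)
open import Data.Sum using (_⊎_; inj₁; inj₂; [_,_]′; swap)
open import Data.Sum.Function.Propositional using (_⊎-↔_)
open import Data.Sum.Properties using (inj₁-injective; inj₂-injective) renaming (≡-dec to ⊎-≡-dec)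
open import Data.Unit using (⊤; tt)
open import Data.Vec.Functional using (updateAt)
open import Data.Vec.Functional.Properties using (updateAt-updates; updateAt-minimal)
open import Function using (_∘_; _↔_; Inverse; Injective; mk↔ₛ′)
open import Function.Properties.Inverse using (↔-trans)
open import Level using (0ℓ)
open import Relation.Binary.Construct.Closure.ReflexiveTransitive using (Star; ε; _◅_)
open import Relation.Binary.PropositionalEquality
open import Relation.Nullary using (¬_; Dec; yes; no; contradiction; ¬?)
open import Relation.Nullary.Decidable using (map′; recompute; _→-dec_; _×-dec_; _⊎-dec_)
open import Relation.Unary using (Pred; Decidable)
open import Defs

-- Existence of the chromatic number

minimum-exists : ∀ {P : Pred ℕ 0ℓ} → Decidable P → ∀ {n} → P n → ∃[ m ] IsMinimum P m
minimum-exists {P} P? {n} = <-rec (λ n → P n → ∃[ m ] IsMinimum P m) search n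
  where
  search : ∀ n → (∀ {m} → m < n → P m → ∃[ m ] IsMinimum P m) → P n → ∃[ m ] IsMinimum P m
  search n rec pn with anyUpTo? P? n
  ... | yes (m , m<n , pm) = rec m<n pm
  ... | no ¬smaller        = n , pn , λ m pm → ≮⇒≥ λ m<n → ¬smaller (m , m<n , pm)

module Chromatic (G : Graph) where
  open Graph G
  open Inverse enum using (to; from; strictlyInverseˡ)

  Proper : ∀ {c} → (Fin order → Fin c) → Set
  Proper g = ∀ i j → to i ~ to j → g i ≢ g j

  -- `funToFin` numbers the finitely many maps from vertex indices to colours, so properness can be
  -- tested number by number.
  colorable? : Decidable (Colorable G)
  colorable? c = map′ decode encode (any? λ i → proper? (finToFun {c} {order} i))
    where
    proper? : ∀ (g : Fin order → Fin c) → Dec (Proper g)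
    proper? g = all? λ i → all? λ j → (to i ~? to j) →-dec ¬? (g i ≟ᶠ g j)

    decode : ∃[ i ] Proper (finToFun {c} {order} i) → Colorable G c
    decode (i , proper) = finToFun {c} i ∘ from , λ u v u~v →
      proper (from u) (from v)
        (subst₂ _~_ (sym (strictlyInverseˡ u)) (sym (strictlyInverseˡ v)) u~v)

    encode : Colorable G c → ∃[ i ] Proper (finToFun {c} {order} i)
    encode (f , proper) = funToFin (f ∘ to) , λ i j i~j eq → proper (to i) (to j) i~j
      (trans (sym (finToFun-funToFin (f ∘ to) i))
        (trans eq (finToFun-funToFin (f ∘ to) j)))

  order-colorable : Colorable G order
  order-colorable = from , λ u v u~v eq → ~-irr
    (trans (sym (strictlyInverseˡ u)) (trans (cong to eq) (strictlyInverseˡ v))) u~v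

  chromaticNumber-exists : ∃[ χ ] IsChromaticNumber G χ
  chromaticNumber-exists = minimum-exists colorable? order-colorable

-- Ancestors and path lengths in rooted forests

module _ {V : Set} {parent : V → Maybe V} where

  Ancestor : V → V → Set
  Ancestor = Star (λ x y → parent x ≡ just y)

  ancestorAt : ∀ {v m} → PathToRoot parent v m → Fin m → V
  ancestorAt {v} (root _)   _       = v
  ancestorAt {v} (step _ _) zero    = v
  ancestorAt     (step _ p) (suc i) = ancestorAt p i

  ancestor-index : ∀ {u v m} → Ancestor v u → (p : PathToRoot parent v m) →
                   ∃[ i ] ancestorAt p i ≡ u
  ancestor-index ε        (root _)   = zero , refl
  ancestor-index ε        (step _ _) = zero , refl
  ancestor-index (e ◅ _)  (root e′)  = contradiction (trans (sym e) e′) λ ()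
  ancestor-index (e ◅ es) (step e′ p)
    with refl ← just-injective (trans (sym e) e′) =
    let i , eq = ancestor-index es p in suc i , eq

  -- Each ancestor of `v` sits at some position of the path to the root, and different vertices sit
  -- at different positions.
  injective-ancestors⇒≤ : ∀ {v m n} → PathToRoot parent v m → (f : Fin n → V) →
    Injective _≡_ _≡_ f → (∀ i → Ancestor v (f i)) → n ≤ m
  injective-ancestors⇒≤ p f f-injective above = injective⇒≤ {f = index} λ {i} {j} eq →
    f-injective (trans (sym (spec i)) (trans (cong (ancestorAt p) eq) (spec j)))
    where
    index : _ → Fin _
    index i = proj₁ (ancestor-index (above i) p)
    spec : ∀ i → ancestorAt p (index i) ≡ f i
    spec i = proj₂ (ancestor-index (above i) p)

  path-length-unique : ∀ {v m n} → PathToRoot parent v m → PathToRoot parent v n → m ≡ n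
  path-length-unique (root _)   (root _)    = refl
  path-length-unique (root e)   (step e′ _) = contradiction (trans (sym e) e′) λ ()
  path-length-unique (step e _) (root e′)   = contradiction (trans (sym e) e′) λ ()
  path-length-unique (step e p) (step e′ q)
    with refl ← just-injective (trans (sym e) e′) = cong suc (path-length-unique p q)

  ancestor-path-≤ : ∀ {u v m n} → Ancestor v u → PathToRoot parent v m →
                    PathToRoot parent u n → n ≤ m
  ancestor-path-≤ ε        p          q = ≤-reflexive (path-length-unique q p)
  ancestor-path-≤ (e ◅ _)  (root e′)  q = contradiction (trans (sym e) e′) λ ()
  ancestor-path-≤ (e ◅ es) (step e′ p) q
    with refl ← just-injective (trans (sym e) e′) = m≤n⇒m≤1+n (ancestor-path-≤ es p q)

  ancestor-path-< : ∀ {u v m n} → u ≢ v → Ancestor v u → PathToRoot parent v m →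
                    PathToRoot parent u n → n < m
  ancestor-path-< u≢v ε        p          q = contradiction refl u≢v
  ancestor-path-< u≢v (e ◅ _)  (root e′)  q = contradiction (trans (sym e) e′) λ ()
  ancestor-path-< u≢v (e ◅ es) (step e′ p) q
    with refl ← just-injective (trans (sym e) e′) = s≤s (ancestor-path-≤ es p q)

  path-positive : ∀ {v m} → PathToRoot parent v m → 1 ≤ m
  path-positive (root _)   = s≤s z≤n
  path-positive (step _ _) = s≤s z≤n

-- Depth forced by a complete bipartite subgraph

module Treedepth (G : Graph) where
  open Graph G

  depth≤max : ∀ (depth : V → ℕ) v → depth v ≤ max 0 (map depth vertices)
  depth≤max depth v = All.lookup (xs≤max 0 (map depth vertices)) (∈-map⁺ depth v∈vertices)
    where
    open Inverse enum
    v∈vertices : v ∈ vertices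
    v∈vertices = subst (_∈ vertices) (strictlyInverseˡ v) (∈-tabulate⁺ {f = to} (from v))

  module _ (F : RootedForest V) (G⊆F : ∀ {u v} → u ~ v → RootedForest.Closure F u v) where
    open RootedForest F

    -- A neighbour of y that is not deeper than y must be an ancestor of y.
    neighbours⇒deep : ∀ {n} (a : Fin n → V) → Injective _≡_ _≡_ a → ∀ y →
      (∀ i → a i ~ y) → (∀ i → depth (a i) ≤ depth y) → suc n ≤ depth y
    neighbours⇒deep {n} a a-injective y a~y a≤y =
      injective-ancestors⇒≤ (proj₂ (rooted y)) f f-injective above
      where
      f : Fin (suc n) → V
      f zero    = y
      f (suc i) = a i
      f-injective : Injective _≡_ _≡_ f
      f-injective {zero}  {zero}  _  = refl
      f-injective {zero}  {suc j} eq = contradiction (a~y j) (~-irr (sym eq))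
      f-injective {suc i} {zero}  eq = contradiction (a~y i) (~-irr eq)
      f-injective {suc i} {suc j} eq = cong suc (a-injective eq)
      above : ∀ i → f i AncestorOf y
      above zero    = ε
      above (suc i) with G⊆F (a~y i)
      ... | _   , inj₁ a-above-y = a-above-y
      ... | a≢y , inj₂ y-above-a = contradiction (a≤y i)
        (<⇒≱ (ancestor-path-< (a≢y ∘ sym) y-above-a (proj₂ (rooted (a i))) (proj₂ (rooted y))))

    deepest : ∀ {n} (x : Fin (suc n) → V) → ∃[ i ] (∀ j → depth (x j) ≤ depth (x i))
    deepest x = argmax (depth ∘ x) zero (allFin _) ,
      λ j → All.lookup (f[xs]≤f[argmax] {f = depth ∘ x} zero (allFin _)) (∈-allFin j)

    -- Take a deepest vertex on each side. The deeper of these two is at least as deep as the whole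
    -- opposite side, so that side consists of ancestors of it.
    completeBipartite⇒deep : ∀ {n} (a b : Fin (suc n) → V) →
      Injective _≡_ _≡_ a → Injective _≡_ _≡_ b → (∀ i j → a i ~ b j) →
      ∃[ y ] suc (suc n) ≤ depth y
    completeBipartite⇒deep a b a-injective b-injective a~b
      with i , a≤aᵢ ← deepest a | j , b≤bⱼ ← deepest b
      with ≤-total (depth (a i)) (depth (b j))
    ... | inj₁ aᵢ≤bⱼ = b j , neighbours⇒deep a a-injective (b j)
                         (λ i′ → a~b i′ j) (λ i′ → ≤-trans (a≤aᵢ i′) aᵢ≤bⱼ)
    ... | inj₂ bⱼ≤aᵢ = a i , neighbours⇒deep b b-injective (a i)
                         (λ j′ → ~-sym (a~b i j′)) (λ j′ → ≤-trans (b≤bⱼ j′) bⱼ≤aᵢ)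

-- Words of bounded length as a rooted forest

-- The head of the word is its latest letter, so the tail is the parent. The bound is irrelevant, so
-- equal words give equal nodes.
record Node (A : Set) (d : ℕ) : Set where
  constructor node
  field
    word   : List A
    .short : length word < d

open Node

module _ {A : Set} where

  extend : ∀ {d} → A → Node A d → Node A (suc d)
  extend x (node h p) = node (x ∷ h) (s≤s p)

  node-enum : ∀ {a} → Fin a ↔ A → ∀ d → ∃[ m ] (Fin m ↔ Node A d)
  node-enum A-enum zero = 0 , ↔-trans 0↔⊥ (mk↔ₛ′ (λ ()) none none (λ ()))
    where
    none : ∀ {B : Node A zero → Set} → (v : Node A zero) → B v
    none (node _ p) = ⊥-elim-irr (n≮0 p)
  node-enum {a} A-enum (suc d) = let m , enum = node-enum A-enum d in
    1 + a * m , ↔-trans +↔⊎ (↔-trans (1↔⊤ ⊎-↔ ↔-trans *↔× (A-enum ×-↔ enum)) unfold)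
    where
    to : ⊤ ⊎ (A × Node A d) → Node A (suc d)
    to (inj₁ _)       = node [] (s≤s z≤n)
    to (inj₂ (x , v)) = extend x v
    from : Node A (suc d) → ⊤ ⊎ (A × Node A d)
    from (node [] _)      = inj₁ tt
    from (node (x ∷ h) p) = inj₂ (x , node h (s≤s⁻¹ p))
    to-from : ∀ v → to (from v) ≡ v
    to-from (node [] _)      = refl
    to-from (node (x ∷ h) p) = refl
    from-to : ∀ s → from (to s) ≡ s
    from-to (inj₁ _)       = refl
    from-to (inj₂ (x , v)) = refl
    unfold : (⊤ ⊎ (A × Node A d)) ↔ Node A (suc d)
    unfold = mk↔ₛ′ to from to-from from-to

  -- Reads x v h: the letters of h are read from its last one to its first one,
  -- and x is read when v has been read.
  data Reads (x : A) (v : List A) : List A → Set where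
    here  : Reads x v (x ∷ v)
    there : ∀ {y h} → Reads x v h → Reads x v (y ∷ h)

  Reads⇒length< : ∀ {x v h} → Reads x v h → length v < length h
  Reads⇒length< here      = ≤-refl
  Reads⇒length< (there r) = m≤n⇒m≤1+n (Reads⇒length< r)

  -- The length of `v` determines where it occurs as a suffix of `h`.
  Reads-functional : ∀ {x y v h} → Reads x v h → Reads y v h → x ≡ y
  Reads-functional here      here      = refl
  Reads-functional here      (there s) = contradiction (Reads⇒length< s) (<-irrefl refl)
  Reads-functional (there r) here      = contradiction (Reads⇒length< r) (<-irrefl refl)
  Reads-functional (there r) (there s) = Reads-functional r s

  _⊏_ : List A → List A → Set
  v ⊏ h = ∃[ x ] Reads x v h

  ⊏-step : ∀ {v x h} → v ⊏ h → v ⊏ (x ∷ h)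
  ⊏-step (_ , r) = _ , there r

  module WordForest (d : ℕ) where

    parent : Node A d → Maybe (Node A d)
    parent (node [] _)      = nothing
    parent (node (x ∷ h) p) = just (node h (<-trans (n<1+n _) p))

    path : ∀ h .(p : length h < d) → PathToRoot parent (node h p) (suc (length h))
    path []      p = root refl
    path (x ∷ h) p = step refl (path h (<-trans (n<1+n _) p))

    forest : RootedForest (Node A d)
    forest = record { parent = parent ; rooted = λ (node h p) → _ , path h p }

    open RootedForest forest using (_AncestorOf_)

    ⊏⇒AncestorOf : ∀ {u v} → word u ⊏ word v → u AncestorOf v
    ⊏⇒AncestorOf {v = node _ p} (_ , r) = climb r p
      where
      climb : ∀ {u x h} → Reads x (word u) h → .(p : length h < d) → u AncestorOf node h p
      climb here      p = refl ◅ ε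
      climb (there r) p = refl ◅ climb r (<-trans (n<1+n _) p)

-- Slots of the game

-- A slot belongs to one colour. It is `empty` if the independent set I has no member of this
-- colour, `one w` if the colour of its member `w` has not been met since, and `two new old` if the
-- later vertex `new` stands in for the member `old`.
data Slot (W : Set) : Set where
  empty : Slot W
  one   : W → Slot W
  two   : (new old : W) → Slot W

module _ {W : Set} where

  -- In the game, `Current` is I after the replacements, `Original` is I itself, and `Replaced`
  -- consists of the neighbours of the next vertex.
  data Current : Slot W → W → Set where
    one : ∀ {u} → Current (one u) u
    two : ∀ {u w} → Current (two u w) u

  data Original : Slot W → W → Set where
    one : ∀ {u} → Original (one u) u
    two : ∀ {u w} → Original (two u w) w

  data Replaced : Slot W → W → Set where
    two : ∀ {u w} → Replaced (two u w) w

  Replaced⇒Original : ∀ {s w} → Replaced s w → Original s w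
  Replaced⇒Original two = two

  replaced? : (∀ (u v : W) → Dec (u ≡ v)) → ∀ s w → Dec (Replaced s w)
  replaced? _≟_ empty     w = no λ ()
  replaced? _≟_ (one _)   w = no λ ()
  replaced? _≟_ (two u v) w with v ≟ w
  ... | yes refl = yes two
  ... | no  v≢w  = no λ { two → v≢w refl }

  settle : Slot W → Slot W
  settle (two u _) = one u
  settle s         = s

  Current-settle : ∀ s {u} → Current (settle s) u → Current s u
  Current-settle (one _)   one = one
  Current-settle (two _ _) one = two

  Original-settle : ∀ s {u} → Original (settle s) u → Current s u
  Original-settle (one _)   one = one
  Original-settle (two _ _) one = two

  ¬Replaced-settle : ∀ s {u} → ¬ Replaced (settle s) u
  ¬Replaced-settle empty ()
  ¬Replaced-settle (one _) ()
  ¬Replaced-settle (two _ _) ()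

module _ {a} {A : Set a} where

  updateAt-elim : ∀ {p} {n} (P : Fin n → A → Set p) (σ : Fin n → A) y x →
    P y x → (∀ i → i ≢ y → P i (σ i)) → ∀ i → P i (updateAt σ y (λ _ → x) i)
  updateAt-elim P σ y x at-y elsewhere i with i ≟ᶠ y
  ... | yes refl = subst (P i) (sym (updateAt-updates y σ)) at-y
  ... | no  i≢y  = subst (P i) (sym (updateAt-minimal i y σ i≢y)) (elsewhere i i≢y)

-- Triangular numbers and finite sums

triangular : ℕ → ℕ
triangular zero    = 0
triangular (suc k) = suc k + triangular k

triangular-mono : ∀ {m n} → m ≤ n → triangular m ≤ triangular n
triangular-mono z≤n       = z≤n
triangular-mono (s≤s m≤n) = +-mono-≤ (s≤s m≤n) (triangular-mono m≤n)

total : ∀ {c} → (Fin c → ℕ) → ℕ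
total {zero}  f = 0
total {suc c} f = f zero + total (f ∘ suc)

total-mono-≤ : ∀ {c} {f g : Fin c → ℕ} → (∀ i → f i ≤ g i) → total f ≤ total g
total-mono-≤ {zero}  f≤g = z≤n
total-mono-≤ {suc c} f≤g = +-mono-≤ (f≤g zero) (total-mono-≤ (f≤g ∘ suc))

total-mono-< : ∀ {c} {f g : Fin c → ℕ} → (∀ i → f i ≤ g i) → ∀ i → f i < g i →
               total f < total g
total-mono-< f≤g zero    f<g = +-mono-<-≤ f<g (total-mono-≤ (f≤g ∘ suc))
total-mono-< f≤g (suc i) f<g = +-mono-≤-< (f≤g zero) (total-mono-< (f≤g ∘ suc) i f<g)

total-≤1 : ∀ {c} {f : Fin c → ℕ} → (∀ i → f i ≤ 1) → total f ≤ c
total-≤1 {zero}  f≤1 = z≤n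
total-≤1 {suc c} f≤1 = +-mono-≤ (f≤1 zero) (total-≤1 (f≤1 ∘ suc))

-- Moves of the game and their progress

module Game (W : Set) (c : ℕ) where

  Slots : Set
  Slots = Fin c → Slot W

  -- An empty slot means a new colour, and the current vertices become the next I; a slot `one v`
  -- means a repeated colour. The last case is a default that no proper colouring reaches, since the
  -- new vertex is adjacent to the replaced member.
  placeIn : Slot W → Slots → Fin c → W → Slots
  placeIn empty     σ y h = updateAt (settle ∘ σ) y (λ _ → one h)
  placeIn (one v)   σ y h = updateAt σ y (λ _ → two h v)
  placeIn (two _ _) σ y h = σ

  place : Slots → Fin c → W → Slots
  place σ y = placeIn (σ y) σ y

  occupied replaced : Slot W → ℕ
  occupied empty     = 0
  occupied (one _)   = 1
  occupied (two _ _) = 1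
  replaced empty     = 0
  replaced (one _)   = 0
  replaced (two _ _) = 1

  replaced≤occupied : ∀ s → replaced s ≤ occupied s
  replaced≤occupied empty     = z≤n
  replaced≤occupied (one _)   = z≤n
  replaced≤occupied (two _ _) = ≤-refl

  occupied≤1 : ∀ s → occupied s ≤ 1
  occupied≤1 empty     = z≤n
  occupied≤1 (one _)   = ≤-refl
  occupied≤1 (two _ _) = ≤-refl

  occupied≤settle : ∀ s → occupied s ≤ occupied (settle s)
  occupied≤settle empty     = ≤-refl
  occupied≤settle (one _)   = ≤-refl
  occupied≤settle (two _ _) = ≤-refl

  -- Bounds the length of a play: collecting s colours takes at most 1 + 2 + ... + s vertices, and
  -- the present phase has used one vertex per replacement.
  progress : Slots → ℕ
  progress σ = triangular (total (occupied ∘ σ)) + total (replaced ∘ σ)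

  progress-bound : ∀ σ → progress σ < triangular (suc c)
  progress-bound σ = s≤s (≤-trans
    (+-mono-≤ (triangular-mono occupied≤c) (≤-trans (total-mono-≤ (replaced≤occupied ∘ σ)) occupied≤c))
    (≤-reflexive (+-comm (triangular c) c)))
    where
    occupied≤c : total (occupied ∘ σ) ≤ c
    occupied≤c = total-≤1 (occupied≤1 ∘ σ)

  -- A new colour at most loses the c′ replacements made among c′ colours,
  -- against a gain of c′ + 1 in the triangular term.
  progress-place : ∀ σ y h → (∀ {u w} → σ y ≢ two u w) → progress σ < progress (place σ y h)
  progress-place σ y h σy≢two with σ y in σy
  ... | two u w = contradiction refl σy≢two
  ... | one v   = +-mono-≤-< (triangular-mono (total-mono-≤ occupied-≤))
                    (total-mono-< replaced-≤ y replaced-<)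
    where
    σ′ : Slots
    σ′ = updateAt σ y (λ _ → two h v)
    occupied-≤ : ∀ i → occupied (σ i) ≤ occupied (σ′ i)
    occupied-≤ = updateAt-elim (λ i s → occupied (σ i) ≤ occupied s) σ y _
      (occupied≤1 (σ y)) (λ _ _ → ≤-refl)
    replaced-≤ : ∀ i → replaced (σ i) ≤ replaced (σ′ i)
    replaced-≤ = updateAt-elim (λ i s → replaced (σ i) ≤ replaced s) σ y _
      (≤-trans (replaced≤occupied (σ y)) (occupied≤1 (σ y))) (λ _ _ → ≤-refl)
    replaced-< : replaced (σ y) < replaced (σ′ y)
    replaced-< rewrite σy | updateAt-updates y {λ _ → two h v} σ = ≤-refl
  ... | empty   = begin-strict
    triangular s + total (replaced ∘ σ)  ≤⟨ +-monoʳ-≤ (triangular s) (total-mono-≤ (replaced≤occupied ∘ σ)) ⟩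
    triangular s + s                     ≡⟨ +-comm (triangular s) s ⟩
    s + triangular s                     <⟨ n<1+n _ ⟩
    triangular (suc s)                   ≤⟨ triangular-mono (total-mono-< occupied-≤ y occupied-<) ⟩
    triangular (total (occupied ∘ σ′))   ≤⟨ m≤m+n _ _ ⟩
    progress σ′                          ∎
    where
    open ≤-Reasoning
    s : ℕ
    s = total (occupied ∘ σ)
    σ′ : Slots
    σ′ = updateAt (settle ∘ σ) y (λ _ → one h)
    occupied-≤ : ∀ i → occupied (σ i) ≤ occupied (σ′ i)
    occupied-≤ = updateAt-elim (λ i s → occupied (σ i) ≤ occupied s) (settle ∘ σ) y _
      (occupied≤1 (σ y)) (λ i _ → occupied≤settle (σ i))
    occupied-< : occupied (σ y) < occupied (σ′ y)
    occupied-< rewrite σy | updateAt-updates y {λ _ → one h} (settle ∘ σ) = ≤-refl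

  Current-place : ∀ σ y h {i u} → Current (place σ y h i) u →
                  (i ≡ y × u ≡ h) ⊎ Current (σ i) u
  Current-place σ y h {i} {u} with σ y
  ... | empty   = updateAt-elim (λ i s → Current s u → (i ≡ y × u ≡ h) ⊎ Current (σ i) u)
                    (settle ∘ σ) y _ (λ { one → inj₁ (refl , refl) })
                    (λ i _ → inj₂ ∘ Current-settle (σ i)) i
  ... | one v   = updateAt-elim (λ i s → Current s u → (i ≡ y × u ≡ h) ⊎ Current (σ i) u)
                    σ y _ (λ { two → inj₁ (refl , refl) }) (λ _ _ → inj₂) i
  ... | two _ _ = inj₂

  -- Either the phase continues and I stays fixed, or a new phase starts from the current vertices
  -- and `h`. The choice is made once for all slots, so that pairs of originals can be treated in a
  -- single case.
  Original-place : ∀ σ y h →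
    (∀ {i u} → Original (place σ y h i) u → Original (σ i) u) ⊎
    (∀ {i u} → Original (place σ y h i) u → (i ≡ y × u ≡ h) ⊎ Current (σ i) u)
  Original-place σ y h with σ y in σy
  ... | empty   = inj₂ λ {i} {u} →
                    updateAt-elim (λ i s → Original s u → (i ≡ y × u ≡ h) ⊎ Current (σ i) u)
                      (settle ∘ σ) y _ (λ { one → inj₁ (refl , refl) })
                      (λ i _ → inj₂ ∘ Original-settle (σ i)) i
  ... | one v   = inj₁ λ {i} {u} → updateAt-elim (λ i s → Original s u → Original (σ i) u)
                    σ y _ (λ { two → subst (λ s → Original s v) (sym σy) one }) (λ _ _ o → o) i
  ... | two _ _ = inj₁ λ o → o

  Current-Replaced-place : ∀ σ y h →
    (∀ {u} → Original (σ y) u → u ≢ h) →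
    (∀ {i u} → Current (σ i) u → ¬ Replaced (σ i) u) →
    ∀ {i u} → Current (place σ y h i) u → ¬ Replaced (place σ y h i) u
  Current-Replaced-place σ y h fresh distinct {i} {u} with σ y
  ... | empty   = updateAt-elim (λ i s → Current s u → ¬ Replaced s u) (settle ∘ σ) y _
                    (λ _ ()) (λ i _ _ → ¬Replaced-settle (σ i)) i
  ... | one v   = updateAt-elim (λ i s → Current s u → ¬ Replaced s u) σ y _
                    (λ { two two → fresh one refl }) (λ _ _ → distinct) i
  ... | two _ _ = distinct

-- States of the game and independent neighbourhoods

module Construction (c n : ℕ) where

  Letter Word : Set
  Letter = Fin c ⊎ Fin n
  Word   = List Letter

  open Game Word c

  _≟ʷ_ : (u v : Word) → Dec (u ≡ v)
  _≟ʷ_ = ≡-dec (⊎-≡-dec _≟ᶠ_ _≟ᶠ_)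

  open DecMembership _≟ʷ_ using (_∈?_)

  data State : Set where
    playing : Slots → State
    aside   : List Word → State

  -- A letter inj₁ y is the colour y given to the vertex read so far.  The
  -- letters inj₂ j leave the game: there, the words of length n are joined to
  -- all vertices passed since, which yields a complete bipartite graph.
  advance : State → Word → Letter → State
  advance (playing σ) h (inj₁ y) = playing (place σ y h)
  advance (playing σ) h (inj₂ _) = aside (h ∷ [])
  advance (aside us)  h _        = aside (h ∷ us)

  state : Word → State
  state []      = playing (λ _ → empty)
  state (x ∷ h) = advance (state h) h x

  Joined : State → Word → Word → Set
  Joined (playing σ) h u = ∃[ i ] Replaced (σ i) u
  Joined (aside us)  h u = length h ≡ n × u ∈ us

  infix 4 _◂_
  _◂_ : Word → Word → Set
  u ◂ h = Joined (state h) h u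

  _◂?_ : ∀ u h → Dec (u ◂ h)
  u ◂? h with state h
  ... | playing σ = any? λ i → replaced? _≟ʷ_ (σ i) u
  ... | aside us  = (length h ≟ n) ×-dec (u ∈? us)

  -- Recording the letter read after each vertex makes all neighbours ancestors and tells the slots
  -- apart.
  record ReadSlots (σ : Slots) (h : Word) : Set where
    field
      current-read  : ∀ {i u} → Current (σ i) u → Reads (inj₁ i) u h
      original-read : ∀ {i u} → Original (σ i) u → Reads (inj₁ i) u h

  open ReadSlots

  Read : State → Word → Set
  Read (playing σ) h = ReadSlots σ h
  Read (aside us)  h = ∀ {u} → u ∈ us → u ⊏ h

  place-read : ∀ {σ h} y → ReadSlots σ h → ReadSlots (place σ y h) (inj₁ y ∷ h)
  place-read {σ} {h} y read = record
    { current-read  = λ cur → new (Current-place σ y h cur)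
    ; original-read = λ orig → [ (λ old → there (original-read read (old orig)))
                               , (λ old → new (old orig)) ]′ (Original-place σ y h)
    }
    where
    new : ∀ {i u} → (i ≡ y × u ≡ h) ⊎ Current (σ i) u → Reads (inj₁ i) u (inj₁ y ∷ h)
    new (inj₁ (refl , refl)) = here
    new (inj₂ cur)           = there (current-read read cur)

  state-read : ∀ h → Read (state h) h
  state-read []      = record { current-read = λ () ; original-read = λ () }
  state-read (x ∷ h) with state h | state-read h | x
  ... | playing σ | read | inj₁ y = place-read y read
  ... | playing σ | read | inj₂ _ = λ { (here refl) → _ , here }
  ... | aside us  | read | _      = λ { (here refl) → _ , here ; (there u∈us) → ⊏-step (read u∈us) }

  ◂⇒⊏ : ∀ {u h} → u ◂ h → u ⊏ h
  ◂⇒⊏ {h = h} u◂h with state h | state-read h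
  ◂⇒⊏ (i , rep)     | playing σ | read = _ , original-read read (Replaced⇒Original rep)
  ◂⇒⊏ (_ , u∈us)    | aside us  | read = read u∈us

  ◂⇒length< : ∀ {u h} → u ◂ h → length u < length h
  ◂⇒length< u◂h = Reads⇒length< (proj₂ (◂⇒⊏ u◂h))

  Independent : (Word → Set) → Set
  Independent P = ∀ {u v} → P u → P v → ¬ u ◂ v

  -- Originals that are not replaced yet are included in the second condition
  -- since they may later join the replaced ones in a neighbourhood.
  record FreeSlots (σ : Slots) : Set where
    field
      current-independent  : Independent (λ u → ∃[ i ] Current (σ i) u)
      original-independent : Independent (λ u → ∃[ i ] Original (σ i) u)
      current-unreplaced   : ∀ {i u} → Current (σ i) u → ¬ Replaced (σ i) u

  open FreeSlots

  Free : State → Set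
  Free (playing σ) = FreeSlots σ
  Free (aside us)  = Independent (_∈ us)

  place-free : ∀ {σ h} y → state h ≡ playing σ → ReadSlots σ h → FreeSlots σ →
               FreeSlots (place σ y h)
  place-free {σ} {h} y state≡ read free = record
    { current-independent  = λ (_ , p) (_ , q) →
        extended (weaken (Current-place σ y h p)) (weaken (Current-place σ y h q))
    ; original-independent = λ (_ , p) (_ , q) → [ (λ old →
        original-independent free (_ , old p) (_ , old q)) , (λ old →
        extended (weaken (old p)) (weaken (old q))) ]′ (Original-place σ y h)
    ; current-unreplaced   = Current-Replaced-place σ y h
        (λ o u≡h → <-irrefl (cong length u≡h) (Reads⇒length< (original-read read o)))
        (current-unreplaced free)
    }
    where
    Extended : Word → Set
    Extended u = u ≡ h ⊎ (∃[ i ] Current (σ i) u)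
    weaken : ∀ {i u} → (i ≡ y × u ≡ h) ⊎ Current (σ i) u → Extended u
    weaken (inj₁ (_ , u≡h)) = inj₁ u≡h
    weaken (inj₂ cur)       = inj₂ (_ , cur)
    shorter : ∀ {i u} → Current (σ i) u → length u < length h
    shorter = Reads⇒length< ∘ current-read read
    extended : Independent Extended
    extended (inj₁ refl)      (inj₁ refl)      h◂h = <-irrefl refl (◂⇒length< h◂h)
    extended (inj₁ refl)      (inj₂ (_ , cur)) h◂v = <-asym (◂⇒length< h◂v) (shorter cur)
    extended (inj₂ p)         (inj₂ q)         u◂v = current-independent free p q u◂v
    -- If `u` were joined to `h`, it would be replaced in some slot `j`. The letter read after `u`
    -- forces `j` to be `i`, but no slot has its current vertex replaced.
    extended (inj₂ (i , cur)) (inj₁ refl)      u◂h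
      with j , rep ← subst (λ s → Joined s h _) state≡ u◂h
      with refl ← Reads-functional (current-read read cur)
                                   (original-read read (Replaced⇒Original rep))
      = current-unreplaced free cur rep

  state-free : ∀ h → length h ≤ n → Free (state h)
  state-free []      _ = record
    { current-independent = λ () ; original-independent = λ () ; current-unreplaced = λ () }
  state-free (x ∷ h) ∣h∣<n with state h in state≡ | state-read h | state-free h (<⇒≤ ∣h∣<n) | x
  ... | playing σ | read | free | inj₁ y = place-free y state≡ read free
  ... | playing σ | read | free | inj₂ _ = λ { (here refl) (here refl) h◂h →
                                                 <-irrefl refl (◂⇒length< h◂h) }
  ... | aside us  | read | free | _      = extended
    where
    extended : Independent (_∈ (h ∷ us))
    extended (here refl) (here refl) h◂h = <-irrefl refl (◂⇒length< h◂h)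
    extended (here refl) (there v∈us) h◂v =
      <-asym (◂⇒length< h◂v) (Reads⇒length< (proj₂ (read v∈us)))
    -- Off the game only words of length `n` have earlier neighbours, and `h` is shorter.
    extended (there u∈us) (here refl) u◂h =
      <⇒≢ ∣h∣<n (proj₁ (subst (λ s → Joined s h _) state≡ u◂h))
    extended (there u∈us) (there v∈us) = free u∈us v∈us

  ◂-independent : ∀ h → length h ≤ n → Independent (_◂ h)
  ◂-independent h ∣h∣≤n with state h | state-free h ∣h∣≤n
  ... | playing σ | free = λ (_ , p) (_ , q) → original-independent free
                             (_ , Replaced⇒Original p) (_ , Replaced⇒Original q)
  ... | aside us  | free = λ (_ , u∈us) (_ , v∈us) → free u∈us v∈us

  -- The graph and its triangle-freeness

  V : Set
  V = Node Letter (suc n)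

  infix 4 _~_
  _~_ : V → V → Set
  u ~ v = word u ◂ word v ⊎ word v ◂ word u

  graph : Graph
  graph = record
    { V     = V
    ; order = proj₁ (node-enum (+↔⊎ {c} {n}) (suc n))
    ; enum  = proj₂ (node-enum (+↔⊎ {c} {n}) (suc n))
    ; _~_   = _~_
    ; ~-sym = swap
    ; ~-irr = λ { refl → [ irreflexive , irreflexive ]′ }
    ; _~?_  = λ u v → (word u ◂? word v) ⊎-dec (word v ◂? word u)
    }
    where
    irreflexive : ∀ {h} → ¬ h ◂ h
    irreflexive = <-irrefl refl ∘ ◂⇒length<

  length≤n : (v : V) → length (word v) ≤ n
  length≤n (node h p) = recompute (length h ≤? n) (s≤s⁻¹ p)

  -- In a triangle the longest word would have two adjacent earlier neighbours, against
  -- `◂-independent`; the two cyclic orientations contradict the order by length.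
  triangleFree : TriangleFree graph
  triangleFree u v w (inj₁ u◂v) (inj₁ v◂w) (inj₁ u◂w) = ◂-independent _ (length≤n w) u◂w v◂w u◂v
  triangleFree u v w (inj₁ u◂v) (inj₁ v◂w) (inj₂ w◂u) =
    <-asym (<-trans (◂⇒length< u◂v) (◂⇒length< v◂w)) (◂⇒length< w◂u)
  triangleFree u v w (inj₁ u◂v) (inj₂ w◂v) (inj₁ u◂w) = ◂-independent _ (length≤n v) u◂v w◂v u◂w
  triangleFree u v w (inj₁ u◂v) (inj₂ w◂v) (inj₂ w◂u) = ◂-independent _ (length≤n v) w◂v u◂v w◂u
  triangleFree u v w (inj₂ v◂u) (inj₁ v◂w) (inj₁ u◂w) = ◂-independent _ (length≤n w) v◂w u◂w v◂u
  triangleFree u v w (inj₂ v◂u) (inj₁ v◂w) (inj₂ w◂u) = ◂-independent _ (length≤n u) v◂u w◂u v◂w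
  triangleFree u v w (inj₂ v◂u) (inj₂ w◂v) (inj₁ u◂w) =
    <-asym (<-trans (◂⇒length< w◂v) (◂⇒length< v◂u)) (◂⇒length< u◂w)
  triangleFree u v w (inj₂ v◂u) (inj₂ w◂v) (inj₂ w◂u) = ◂-independent _ (length≤n u) w◂u v◂u w◂v

  -- Lower bound on the chromatic number

  -- Every colouring singles out one play, in which each letter is the colour
  -- of the vertex read before it.
  module Play (f : V → Fin c) (proper : ∀ u v → u ~ v → f u ≢ f v) where

    record Position (i : ℕ) : Set where
      field
        history         : Word
        slots           : Slots
        history-length  : length history ≡ i
        history-state   : state history ≡ playing slots
        history-colours : ∀ {x v} .(p : length v < suc n) → Reads x v history → x ≡ inj₁ (f (node v p))
        many-steps      : i ≤ progress slots

    open Position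

    position : ∀ i → i ≤ suc n → Position i
    position zero    _    = record
      { history         = []
      ; slots           = λ _ → empty
      ; history-length  = refl
      ; history-state   = refl
      ; history-colours = λ _ ()
      ; many-steps      = z≤n
      }
    position (suc i) i<d = record
      { history         = inj₁ y ∷ h
      ; slots           = place σ y h
      ; history-length  = cong suc (history-length pos)
      ; history-state   = cong (λ s → advance s h (inj₁ y)) (history-state pos)
      ; history-colours = λ { p here → refl ; p (there r) → history-colours pos p r }
      ; many-steps      = ≤-<-trans (many-steps pos) (progress-place σ y h y-unreplaced)
      }
      where
      pos : Position i
      pos = position i (<⇒≤ i<d)
      h : Word
      h = history pos
      σ : Slots
      σ = slots pos
      ∣h∣<d : length h < suc n
      ∣h∣<d = subst (_< suc n) (sym (history-length pos)) i<d
      y : Fin c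
      y = f (node h ∣h∣<d)
      y-unreplaced : ∀ {u w} → σ y ≢ two u w
      -- A replaced `w` in slot `y` would be adjacent to the present vertex, while the letter read
      -- after `w` says that `w` has colour `y` as well.
      y-unreplaced {u} {w} σy≡two = proper (node w ∣w∣<d) (node h ∣h∣<d) (inj₁ w◂h)
        (sym (inj₁-injective (history-colours pos ∣w∣<d w-read)))
        where
        w-read : Reads (inj₁ y) w h
        w-read = original-read (subst (λ s → Read s h) (history-state pos) (state-read h))
          (subst (λ s → Original s w) (sym σy≡two) two)
        ∣w∣<d : length w < suc n
        ∣w∣<d = <-trans (Reads⇒length< w-read) ∣h∣<d
        w◂h : w ◂ h
        w◂h = subst (λ s → Joined s h w) (sym (history-state pos))
          (y , subst (λ s → Replaced s w) (sym σy≡two) two)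

    few-vertices : suc n < triangular (suc c)
    few-vertices = ≤-<-trans (many-steps end) (progress-bound (slots end))
      where
      end : Position (suc n)
      -- A history of length `suc n` is too long to be a vertex, but its proper suffixes are `suc n`
      -- coloured vertices.
      end = position (suc n) ≤-refl

  uncolorable : triangular (suc c) ≤ suc n → ∀ {m} → Colorable graph m → suc c ≤ m
  uncolorable long (f , proper) = ≮⇒≥ λ m<1+c → let m≤c = s≤s⁻¹ m<1+c in
    <⇒≱ (Play.few-vertices (λ v → inject≤ (f v) m≤c)
          (λ u v u~v eq → proper u v u~v (inject≤-injective m≤c m≤c _ _ eq)))
        long

-- Exact treedepth

-- The game is left at the empty word, so all shorter powers of the letter are collected. The latest
-- letter `j` stays free to allow branching.
aside-replicate : ∀ {c n} (x : Fin n) m j → let open Construction c n in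
  ∃[ us ] state (inj₂ j ∷ replicate m (inj₂ x)) ≡ aside us ×
          (∀ {i} → i ≤ m → replicate i (inj₂ x) ∈ us)
aside-replicate         x zero    j = _ , refl , λ { z≤n → here refl }
aside-replicate {c} {n} x (suc m) j with us , eq , all∈us ← aside-replicate {c} x m x =
  _ , cong (λ s → advance s (inj₂ x ∷ replicate m (inj₂ x)) (inj₂ j)) eq ,
  λ i≤1+m → [ (λ i<1+m → there (all∈us (s≤s⁻¹ i<1+m))) , (λ { refl → here refl }) ]′
              (m≤n⇒m<n∨m≡n i≤1+m)
  where open Construction c n

-- One side of a complete bipartite graph consists of the powers of a letter below maximal length,
-- the other of longest words differing only in the latest letter. The `n` additional letters make
-- both sides equally large.
deep-vertex : ∀ c n → let open Construction c n in
  (F : RootedForest V) → (∀ {u v} → u ~ v → RootedForest.Closure F u v) →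
  ∃[ v ] suc n ≤ RootedForest.depth F v
deep-vertex c zero    F G⊆F = node [] (s≤s z≤n) , path-positive (proj₂ (RootedForest.rooted F _))
deep-vertex c (suc n) F G⊆F =
  Treedepth.completeBipartite⇒deep graph F G⊆F chain leaf chain-injective leaf-injective joined
  where
  open Construction c (suc n)
  z : Letter
  z = inj₂ zero
  chain leaf : Fin (suc n) → V
  chain i = node (replicate (toℕ i) z)
    (s≤s (subst (_≤ suc n) (sym (length-replicate (toℕ i))) (<⇒≤ (toℕ<n i))))
  leaf j = node (inj₂ j ∷ replicate n z) (s≤s (s≤s (≤-reflexive (length-replicate n))))
  chain-injective : Injective _≡_ _≡_ chain
  chain-injective {i} {j} eq = toℕ-injective (trans (sym (length-replicate (toℕ i)))
    (trans (cong (length ∘ word) eq) (length-replicate (toℕ j))))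
  leaf-injective : Injective _≡_ _≡_ leaf
  leaf-injective = inj₂-injective ∘ ∷-injectiveˡ ∘ cong word
  joined : ∀ i j → chain i ~ leaf j
  joined i j with us , eq , all∈us ← aside-replicate {c} (zero {n}) n j =
    inj₁ (subst (λ s → Joined s (word (leaf j)) (word (chain i))) (sym eq)
      (cong suc (length-replicate n) , all∈us (s≤s⁻¹ (toℕ<n i))))

treedepth : ∀ c n → IsTreedepth (Construction.graph c n) (suc n)
-- `lower` serves twice: it makes the depth of the word forest exactly `suc n`, and it gives
-- minimality among all forests.
treedepth c n = (forest , G⊆F , ≤-antisym depth-≤ (lower forest G⊆F)) ,
  λ { m (F , G⊆F′ , refl) → lower F G⊆F′ }
  where
  open Construction c n
  open WordForest {Letter} (suc n)
  G⊆F : ∀ {u v} → u ~ v → RootedForest.Closure forest u v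
  G⊆F {u} {v} u~v = (λ u≡v → Graph.~-irr graph u≡v u~v) ,
    [ (λ p → inj₁ (⊏⇒AncestorOf {u = u} {v} (◂⇒⊏ p)))
    , (λ p → inj₂ (⊏⇒AncestorOf {u = v} {u} (◂⇒⊏ p))) ]′ u~v
  depth-≤ : max 0 (map (RootedForest.depth forest) (Graph.vertices graph)) ≤ suc n
  depth-≤ = max≤v⁺ z≤n (map⁺ (All.universal (λ v → s≤s (length≤n v)) (Graph.vertices graph)))
  lower : (F : RootedForest V) → (∀ {u v} → u ~ v → RootedForest.Closure F u v) →
          suc n ≤ max 0 (map (RootedForest.depth F) (Graph.vertices graph))
  lower F G⊆F = let v , deep = deep-vertex c n F G⊆F in
    ≤-trans deep (Treedepth.depth≤max graph (RootedForest.depth F) v)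

-- Binomial form of the bound and conclusion

triangular≡C : ∀ k → (k + 1) C 2 ≡ triangular k
triangular≡C zero    = refl
triangular≡C (suc k) = begin
  suc (k + 1) C 2               ≡⟨ nCk+nC[k+1]≡[n+1]C[k+1] (k + 1) 1 ⟨
  (k + 1) C 1 + (k + 1) C 2     ≡⟨ cong₂ _+_ (trans (nC1≡n (k + 1)) (+-comm k 1)) (triangular≡C k) ⟩
  suc k + triangular k          ∎
  where open ≡-Reasoning

theorem10 : ∀ (k : ℕ) → k ≥ 1 →
    Σ[ G ∈ Graph ]
    TriangleFree G ×
    IsTreedepth G ((k + 1) C 2) ×
    (∃[ χ ] (IsChromaticNumber G χ × χ ≥ k))
theorem10 (suc c) _ =
  let χ , isχ@(colorable , _) = Chromatic.chromaticNumber-exists graph in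
  graph , triangleFree , subst (IsTreedepth graph) (sym (triangular≡C (suc c))) (treedepth c n) ,
  χ , isχ , uncolorable ≤-refl colorable
  where
  -- With this value, `suc n` is `triangular (suc c)` by computation.
  n : ℕ
  n = c + triangular c
  open Construction c n
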